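{- There exists an absolute constant $C$ such that the following holds. Let $m>1$ be an integer having $d$ prime factors counted with multiplicity. If a polynomial $f\in \mathbb{Z}_m[x_1,\ldots,x_n]$ of degree at most $2$ weakly represents $\mathrm{OR}_n$ modulo $m$, then \[ n\le m^{Cd}\le m^{C\log_2 m}. \]
   Context: Let $B=\{0,1\}\subseteq\mathbb{Z}$ and $\mathbb{Z}_m$ the ring of integers modulo $m$. The function $\mathrm{OR}_n:B^n\to B$ is defined by $\mathrm{OR}_n(\mathbf 0)=0$ and $\mathrm{OR}_n(\mathbf x)=1$ for $\mathbf x\neq \mathbf 0$. A function $f:B^n\to\mathbb{Z}_m$ (here a polynomial over $\mathbb{Z}_m$ evaluated at points of $B^n$) weakly represents a function $g:B^n\to B$ if there is a partition $\mathbb{Z}_m=A\cup A^c$ such that for all $\mathbf x\in B^n$: $g(\mathbf x)=0 \iff f(\mathbf x)\in A$ and $g(\mathbf x)=1\iff f(\mathbf x)\in A^c$. -}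

module Defs where

open import Data.Nat using (ℕ; zero; suc; _+_; _*_; NonZero)
open import Data.Nat.DivMod using (_mod_)
open import Data.Bool using (Bool; true; false; _∨_)
open import Data.Fin using (Fin; toℕ)
import Data.Fin as Fin
open import Data.Fin.Subset using (Subset; _∈_)
open import Data.Product using (∃; _×_)
open import Function.Bundles using (_⇔_)
open import Relation.Binary.PropositionalEquality using (_≡_)

val : Bool → ℕ
val false = 0
val true  = 1

BVec : ℕ → Set
BVec n = Fin n → Bool

sumFin : (n : ℕ) → (Fin n → ℕ) → ℕ
sumFin zero    g = 0
sumFin (suc n) g = g Fin.zero + sumFin n (λ i → g (Fin.suc i))

OR : (n : ℕ) → BVec n → Bool
OR zero    x = false
OR (suc n) x = x Fin.zero ∨ OR n (λ i → x (Fin.suc i))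

-- A polynomial in Z_m[x_1,…,x_n] of degree at most 2, given by its coefficients:
--   f = c + Σ_i a_i x_i + Σ_{i,j} b_{ij} x_i x_j   (every such polynomial has this form)
record Deg2Poly (m n : ℕ) : Set where
  field
    const : Fin m
    lin   : Fin n → Fin m
    quad  : Fin n → Fin n → Fin m
open Deg2Poly public

eval : {m n : ℕ} .{{_ : NonZero m}} → Deg2Poly m n → BVec n → Fin m
eval {m} {n} f x =
  (toℕ (const f)
   + sumFin n (λ i → toℕ (lin f i) * val (x i))
   + sumFin n (λ i → sumFin n (λ j → toℕ (quad f i j) * val (x i) * val (x j))))
  mod m

-- f weakly represents g: there is a partition Z_m = A ∪ A^c with
-- g(x) = 0 ⇔ f(x) ∈ A (and hence g(x) = 1 ⇔ f(x) ∈ A^c).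
WeaklyRepresents : {m n : ℕ} .{{_ : NonZero m}} → Deg2Poly m n → (BVec n → Bool) → Set
WeaklyRepresents {m} {n} f g =
  ∃ λ (A : Subset m) → (x : BVec n) → (g x ≡ false) ⇔ (eval f x ∈ A)

{-# OPTIONS --safe #-}
module Submission where

open import Defs
open import Data.Bool using (Bool; true; false; _∨_)
import Data.Bool.Properties as Bool
open import Data.Fin using (Fin; zero; suc; toℕ; _≟_)
open import Data.Fin.Properties using (toℕ-injective; toℕ-fromℕ<)
import Data.Fin.Subset as Subset
open import Data.Fin.Subset.Properties using (anySubset?)
open import Data.Integer using (ℤ; +_; -_; 0ℤ; 1ℤ)
import Data.Integer as ℤ
import Data.Integer.Divisibility.Signed as ℤ
import Data.Integer.Properties as ℤ
import Data.Integer.Tactic.RingSolver as ℤ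
open import Data.List using (List; []; _∷_; [_]; _++_; length; map; foldr; concat; take; drop; tabulate; allFin; applyUpTo; cartesianProduct)
import Data.List.Membership.DecPropositional as DecMembership
open import Data.List.Membership.Propositional using (_∈_; find)
open import Data.List.Membership.Propositional.Properties using (∈-applyUpTo⁺; ∈-applyUpTo⁻; ∈-cartesianProduct⁺; ∈-cartesianProduct⁻)
open import Data.List.Properties using (++-assoc; concat-++; length-++; length-++-≤ʳ; length-applyUpTo; length-drop; length-map; length-tabulate; length-take; map-++; map-cong-local; map-tabulate; take++drop≡id)
open import Data.List.Relation.Binary.Permutation.Propositional using (_↭_; module _↭_; prep; ↭-refl; ↭-sym; ↭-trans; ↭⇒↭ₛ; module PermutationReasoning)
open import Data.List.Relation.Binary.Permutation.Propositional.Properties using (All-resp-↭; map⁺; ++⁺ˡ; ++⁺ʳ; ++-comm; shift; shifts)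
import Data.List.Relation.Binary.Permutation.Setoid.Properties as Permutationₛ
open import Data.List.Relation.Unary.All as All using (All; []; _∷_)
open import Data.List.Relation.Unary.All.Properties using (++⁻ˡ; ++⁻ʳ; ¬All⇒Any¬) renaming (map⁻ to All-map⁻)
open import Data.List.Relation.Unary.AllPairs using (AllPairs; []; _∷_)
open import Data.List.Relation.Unary.Any using (here; there)
open import Data.List.Relation.Unary.Unique.Propositional.Properties using (allFin⁺)
open import Data.Nat using (ℕ; zero; suc; pred; _+_; _*_; _∸_; _^_; _/_; _%_; _≤_; _<_; z≤n; s≤s; z<s; NonZero; nonTrivial⇒n>1)
open import Data.Nat.Divisibility
open import Data.Nat.DivMod
open import Data.Nat.ListAction using (sum; product)
open import Data.Nat.ListAction.Properties using (sum-++; sum-↭)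
open import Data.Nat.Logarithm using (⌊log₂_⌋; ⌊log₂⌋-mono-≤; ⌊log₂[2^n]⌋≡n)
open import Data.Nat.Primality using (Prime; ¬prime[1]; euclidsLemma; prime⇒nonTrivial; prime⇒nonZero)
open import Data.Nat.Primality.Factorisation using (PrimeFactorisation; factors)
open import Data.Nat.Properties hiding (_≟_)
open import Data.Nat.Tactic.RingSolver using (solve-∀)
open import Data.Product using (∃; ∃₂; _×_; _,_; proj₁; proj₂)
open import Data.Sum using (inj₁; inj₂)
open import Data.Unit using (⊤; tt)
open import Data.Vec using (Vec; []; _∷_; replicate)
open import Data.Vec.Properties using (≡-dec; ∷-injectiveʳ)
open import Function using (_∘_; id)
open import Function.Bundles using (Equivalence)
open import Relation.Binary.PropositionalEquality hiding ([_])
open import Relation.Nullary using (¬_; ¬?; yes; no; does; contradiction; _×-dec_)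
open import Relation.Nullary.Decidable using (dec-true; dec-false)

-- Suppose n ≥ m·(m^d·m). Among any K^d·m vectors of (ℤ/m)^K some nonempty subfamily sums to
-- zero: for m prime this is a weak form of Olson’s bound, by the polynomial method on the cube, and the
-- primes of m are treated one at a time, a zero-sum family modulo p being a new vector modulo m/p.
-- With K = m one extracts greedily m disjoint nonempty sets S₁,…,S_m of variables, each annihilated
-- modulo m by the linear forms through which the quadratic part couples it to the earlier ones.
-- On unions of these sets f − f(0) is additive modulo m, and among the m values (f − f(0))(S_i)
-- some nonempty subfamily sums to zero; so f takes the value f(0) at a nonzero point.

private variable
  A : Set
  n : ℕ

-- Functions of bounded degree on the cube

chosen others : (xs : List A) → Vec Bool (length xs) → List A
chosen []       []          = []
chosen (x ∷ xs) (true  ∷ b) = x ∷ chosen xs b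
chosen (x ∷ xs) (false ∷ b) = chosen xs b
others []       []          = []
others (x ∷ xs) (true  ∷ b) = others xs b
others (x ∷ xs) (false ∷ b) = x ∷ others xs b

∂ : (Vec Bool (suc n) → ℤ) → Vec Bool n → ℤ
∂ h b = h (true ∷ b) ℤ.- h (false ∷ b)

-- DegLt p n D h: modulo p, the function h on the n-cube is a polynomial of degree < D.
DegLt : ℤ → (n D : ℕ) → (Vec Bool n → ℤ) → Set
DegLt p n       zero    h = ∀ b → p ℤ.∣ h b
DegLt p zero    (suc D) h = ⊤
DegLt p (suc n) (suc D) h = DegLt p n (suc D) (h ∘ (false ∷_)) × DegLt p n D (∂ h)

module _ {p : ℤ} where

  vanishing⇒degLt : ∀ n D {h} → (∀ b → p ℤ.∣ h b) → DegLt p n D h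
  vanishing⇒degLt n       zero    v = v
  vanishing⇒degLt zero    (suc D) v = tt
  vanishing⇒degLt (suc n) (suc D) v =
    vanishing⇒degLt n (suc D) (v ∘ (false ∷_)) ,
    vanishing⇒degLt n D (λ b → ℤ.∣m∣n⇒∣m-n (v (true ∷ b)) (v (false ∷ b)))

  degLt-resp-≗ : ∀ n D {g h} → (∀ b → g b ≡ h b) → DegLt p n D g → DegLt p n D h
  degLt-resp-≗ n       zero    g≗h v       = λ b → subst (p ℤ.∣_) (g≗h b) (v b)
  degLt-resp-≗ zero    (suc D) g≗h _       = tt
  degLt-resp-≗ (suc n) (suc D) g≗h (u , v) =
    degLt-resp-≗ n (suc D) (g≗h ∘ (false ∷_)) u ,
    degLt-resp-≗ n D (λ b → cong₂ ℤ._-_ (g≗h (true ∷ b)) (g≗h (false ∷ b))) v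

  degLt-+ : ∀ n D {g h} → DegLt p n D g → DegLt p n D h → DegLt p n D (λ b → g b ℤ.+ h b)
  degLt-+ n       zero            u         v         = λ b → ℤ.∣m∣n⇒∣m+n (u b) (v b)
  degLt-+ zero    (suc D)         u         v         = tt
  degLt-+ (suc n) (suc D) {g} {h} (u₀ , u₁) (v₀ , v₁) =
    degLt-+ n (suc D) u₀ v₀ ,
    degLt-resp-≗ n D (λ b → regroup (g (true ∷ b)) (g (false ∷ b)) (h (true ∷ b)) (h (false ∷ b)))
      (degLt-+ n D u₁ v₁)
    where
    regroup : ∀ g₁ g₀ h₁ h₀ → (g₁ ℤ.- g₀) ℤ.+ (h₁ ℤ.- h₀) ≡ (g₁ ℤ.+ h₁) ℤ.- (g₀ ℤ.+ h₀)
    regroup = ℤ.solve-∀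

  degLt-scale : ∀ n D c {h} → DegLt p n D h → DegLt p n D (λ b → c ℤ.* h b)
  degLt-scale n       zero    c     u         = λ b → ℤ.∣n⇒∣m*n c (u b)
  degLt-scale zero    (suc D) c     u         = tt
  degLt-scale (suc n) (suc D) c {h} (u₀ , u₁) =
    degLt-scale n (suc D) c u₀ ,
    degLt-resp-≗ n D (λ b → distrib c (h (true ∷ b)) (h (false ∷ b))) (degLt-scale n D c u₁)
    where
    distrib : ∀ c h₁ h₀ → c ℤ.* (h₁ ℤ.- h₀) ≡ c ℤ.* h₁ ℤ.- c ℤ.* h₀
    distrib = ℤ.solve-∀

  degLt-const : ∀ n c → DegLt p n 1 (λ _ → c)
  degLt-const zero    c = tt
  degLt-const (suc n) c = degLt-const n c , λ _ → subst (p ℤ.∣_) (sym (ℤ.+-inverseʳ c)) (ℤ.divides 0ℤ refl)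

-- Vertices of the cube stand for subfamilies of `xs`. In the bits this is a polynomial of degree at
-- most 1 whose linear coefficients are the `- φ x`.
affine : (A → ℕ) → (xs : List A) → ℤ → Vec Bool (length xs) → ℤ
affine φ xs c b = c ℤ.- + sum (map φ (chosen xs b))

module _ {p : ℤ} (φ : A → ℕ) where

  -- Induction on `xs` by a discrete Leibniz rule: for an affine factor ℓ, the difference of ℓh is ℓ
  -- on the upper face times `∂ h`, minus `φ x` times h on the lower face. In the first term `∂ h`
  -- has one degree less to begin with, and the induction gives it back; the second is a scalar
  -- multiple of a function already of the allowed degree.
  degLt-affine-* : ∀ xs c D {h} → DegLt p (length xs) D h →
                   DegLt p (length xs) (suc D) (λ b → affine φ xs c b ℤ.* h b)
  degLt-affine-* xs       c zero            v         =
    vanishing⇒degLt (length xs) 1 (λ b → ℤ.∣n⇒∣m*n (affine φ xs c b) (v b))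
  degLt-affine-* []       c (suc D)         v         = tt
  degLt-affine-* (x ∷ xs) c (suc D) {h} (v₀ , v₁) =
    degLt-affine-* xs c (suc D) v₀ ,
    degLt-resp-≗ (length xs) (suc D)
      (λ b → leibniz c (+ φ x) (+ sum (map φ (chosen xs b))) (h (true ∷ b)) (h (false ∷ b)))
      (degLt-+ (length xs) (suc D)
        (degLt-affine-* xs (c ℤ.- + φ x) D v₁)
        (degLt-scale (length xs) (suc D) (0ℤ ℤ.- + φ x) v₀))
    where
    leibniz : ∀ c a s h₁ h₀ →
      ((c ℤ.- a) ℤ.- s) ℤ.* (h₁ ℤ.- h₀) ℤ.+ (0ℤ ℤ.- a) ℤ.* h₀ ≡ (c ℤ.- (a ℤ.+ s)) ℤ.* h₁ ℤ.- (c ℤ.- s) ℤ.* h₀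
    leibniz = ℤ.solve-∀

-- When h vanishes off 0, h(0) is up to sign its n-fold difference, which is 0 in degree < n.
degLt⇒∣h0 : ∀ {p} n D {h} → DegLt p n D h → D ≤ n →
            (∀ b → b ≢ replicate n false → p ℤ.∣ h b) → p ℤ.∣ h (replicate n false)
degLt⇒∣h0 n       zero    v       _         _ = v _
degLt⇒∣h0 {p} (suc n) (suc D) {h} (_ , v) (s≤s D≤n) w =
  subst (p ℤ.∣_) (cancel (h (true ∷ replicate n false)) (h (false ∷ replicate n false)))
    (ℤ.∣m∣n⇒∣m-n (w (true ∷ replicate n false) λ ())
      (degLt⇒∣h0 n D v D≤n
        (λ b b≢0 → ℤ.∣m∣n⇒∣m-n (w (true ∷ b) λ ()) (w (false ∷ b) (b≢0 ∘ ∷-injectiveʳ)))))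
  where
  cancel : ∀ h₁ h₀ → h₁ ℤ.- (h₁ ℤ.- h₀) ≡ h₀
  cancel = ℤ.solve-∀

-- Zero-sum subfamilies modulo a prime

affineProduct : List (ℕ × (A → ℕ)) → (xs : List A) → Vec Bool (length xs) → ℤ
affineProduct cs xs b = foldr (λ (c , φ) z → affine φ xs (+ c) b ℤ.* z) 1ℤ cs

degLt-affineProduct : ∀ {p} (cs : List (ℕ × (A → ℕ))) xs →
                      DegLt p (length xs) (suc (length cs)) (affineProduct cs xs)
degLt-affineProduct []             xs = degLt-const (length xs) 1ℤ
degLt-affineProduct ((c , φ) ∷ cs) xs =
  degLt-affine-* φ xs (+ c) (suc (length cs)) (degLt-affineProduct cs xs)

chosen-zeros : (xs : List A) → chosen xs (replicate _ false) ≡ []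
chosen-zeros []       = refl
chosen-zeros (x ∷ xs) = chosen-zeros xs

chosen≢[] : (xs : List A) (b : Vec Bool (length xs)) → b ≢ replicate _ false → chosen xs b ≢ []
chosen≢[] []       []          b≢0 = contradiction refl b≢0
chosen≢[] (x ∷ xs) (true  ∷ b) b≢0 = λ ()
chosen≢[] (x ∷ xs) (false ∷ b) b≢0 = chosen≢[] xs b (b≢0 ∘ cong (false ∷_))

chosen++others : (xs : List A) (b : Vec Bool (length xs)) → xs ↭ chosen xs b ++ others xs b
chosen++others []       []          = ↭-refl
chosen++others (x ∷ xs) (true  ∷ b) = prep x (chosen++others xs b)
chosen++others (x ∷ xs) (false ∷ b) =
  ↭-trans (prep x (chosen++others xs b)) (↭-sym (shift x (chosen xs b) (others xs b)))

-- `D` is an upper bound for the Davenport constant of (ℤ/m)^K, the functions in `Φ` being the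
-- coordinates. `A` is arbitrary so that lists of elements can later serve as vectors themselves.
-- Allowing fewer than `K` coordinates lets one bound serve while blocks are still being collected.
ZeroSum : (m K D : ℕ) → Set₁
ZeroSum m K D = {A : Set} (Φ : List (A → ℕ)) → length Φ ≤ K → (xs : List A) → D ≤ length xs →
  ∃₂ λ ys zs → xs ↭ ys ++ zs × ys ≢ [] × All (λ φ → m ∣ sum (map φ ys)) Φ

length-cartesianProduct : ∀ {A B : Set} (xs : List A) (ys : List B) →
  length (cartesianProduct xs ys) ≡ length xs * length ys
length-cartesianProduct []       ys = refl
length-cartesianProduct (x ∷ xs) ys = trans (length-++ (map (x ,_) ys))
  (cong₂ _+_ (length-map (x ,_) ys) (length-cartesianProduct xs ys))

-- The factors c − φ with c ranging over the nonzero residues: their product is nonzero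
-- modulo p exactly where p divides every φ.
nonzeroShifts : ℕ → List (A → ℕ) → List (ℕ × (A → ℕ))
nonzeroShifts p Φ = cartesianProduct (applyUpTo suc (pred p)) Φ

∣affineProduct : ∀ {p c} {φ : A → ℕ} {cs} xs b → (c , φ) ∈ cs →
                 p ℤ.∣ affine φ xs (+ c) b → p ℤ.∣ affineProduct cs xs b
∣affineProduct {cs = _ ∷ cs} xs b (here refl) p∣ = ℤ.∣m⇒∣m*n _ p∣
∣affineProduct {cs = (c , φ) ∷ cs} xs b (there c∈) p∣ =
  ℤ.∣n⇒∣m*n (affine φ xs (+ c) b) (∣affineProduct xs b c∈ p∣)

∣affine-zeros∣ : ∀ (φ : A → ℕ) xs c → ℤ.∣ affine φ xs (+ c) (replicate _ false) ∣ ≡ c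
∣affine-zeros∣ φ xs c rewrite chosen-zeros xs = +-identityʳ c

-- At 0 nothing is chosen, so each factor reduces to its constant `c`, and a prime dividing the
-- product would divide some `c`.
∤affineProduct0 : ∀ {p} → Prime p → (cs : List (ℕ × (A → ℕ))) → (∀ {c φ} → (c , φ) ∈ cs → p ∤ c) →
                  ∀ xs → ¬ (+ p ℤ.∣ affineProduct cs xs (replicate _ false))
∤affineProduct0 pp [] p∤ xs p∣ =
  ¬prime[1] (subst Prime (∣1⇒≡1 (ℤ.∣⇒∣ᵤ p∣)) pp)
∤affineProduct0 {p = p} pp ((c , φ) ∷ cs) p∤ xs p∣
  with euclidsLemma _ _ pp (subst (p ∣_) (ℤ.abs-* (affine φ xs (+ c) zeros) _) (ℤ.∣⇒∣ᵤ p∣))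
  where zeros = replicate _ false
... | inj₁ p∣c = p∤ (here refl) (subst (p ∣_) (∣affine-zeros∣ φ xs c) p∣c)
... | inj₂ p∣P = ∤affineProduct0 pp cs (p∤ ∘ there) xs (ℤ.∣ᵤ⇒∣ p∣P)

p∣s%p-s : ∀ p .{{_ : NonZero p}} s → + p ℤ.∣ + (s % p) ℤ.- + s
p∣s%p-s p s = ℤ.divides (- + (s / p)) (begin
  + (s % p) ℤ.- + s                              ≡⟨ cong (λ z → + (s % p) ℤ.- + z) (m≡m%n+[m/n]*n s p) ⟩
  + (s % p) ℤ.- (+ (s % p) ℤ.+ + (s / p * p))    ≡⟨ cancel (+ (s % p)) (+ (s / p * p)) ⟩
  - + (s / p * p)                                ≡⟨ cong -_ (ℤ.pos-* (s / p) p) ⟩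
  - (+ (s / p) ℤ.* + p)                          ≡⟨ ℤ.neg-distribˡ-* (+ (s / p)) (+ p) ⟩
  - + (s / p) ℤ.* + p                            ∎)
  where
  open ≡-Reasoning
  cancel : ∀ r q → r ℤ.- (r ℤ.+ q) ≡ - q
  cancel = ℤ.solve-∀

-- Some sum s has residue r ≠ 0, and r - s is one of the factors. For prime `p` and a single `φ`,
-- the product of all c - s is, up to sign, the polynomial 1 - s^(p-1) of the Chevalley-Warning
-- argument.
∣affineProduct-nonzeroShifts : ∀ p .{{_ : NonZero p}} (Φ : List (A → ℕ)) xs b →
  ¬ All (λ φ → p ∣ sum (map φ (chosen xs b))) Φ →
  + p ℤ.∣ affineProduct (nonzeroShifts p Φ) xs b
∣affineProduct-nonzeroShifts p@(suc _) Φ xs b ¬all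
  with φ , φ∈Φ , p∤s ← find (¬All⇒Any¬ (λ φ → p ∣? sum (map φ (chosen xs b))) Φ ¬all)
  with sum (map φ (chosen xs b)) % p in eq | m%n<n (sum (map φ (chosen xs b))) p
... | zero  | _           = contradiction (m%n≡0⇒n∣m _ p eq) p∤s
... | suc r | s≤s r<p-1   = ∣affineProduct xs b (∈-cartesianProduct⁺ (∈-applyUpTo⁺ suc r<p-1) φ∈Φ)
  (subst (λ r → + p ℤ.∣ + r ℤ.- + sum (map φ (chosen xs b))) eq (p∣s%p-s p (sum (map φ (chosen xs b)))))

∤nonzeroShifts : ∀ p .{{_ : NonZero p}} (Φ : List (A → ℕ)) {c φ} → (c , φ) ∈ nonzeroShifts p Φ → p ∤ c
∤nonzeroShifts p@(suc _) Φ c∈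
  with r , r<p-1 , refl ← ∈-applyUpTo⁻ suc (proj₁ (∈-cartesianProduct⁻ (applyUpTo suc (pred p)) Φ c∈))
  = >⇒∤ (s≤s r<p-1)

-- If every nonempty subfamily failed, the product over `nonzeroShifts` would vanish modulo `p` at
-- all vertices but 0. Its degree, at most K(p - 1), is below the dimension, so it would vanish at 0
-- too, where it is a product of nonzero residues. The bound K·p, weaker than K(p - 1) + 1,
-- multiplies conveniently over the primes.
zeroSum-prime : ∀ {p} → Prime p → ∀ K .{{_ : NonZero K}} → ZeroSum p K (K * p)
zeroSum-prime {p} pp K Φ |Φ|≤K xs Kp≤
  -- A `Subset` is a vector of Booleans, so the existence of a suitable vertex is decidable and may
  -- be refuted by contradiction.
  with anySubset? (λ b → ¬? (≡-dec Bool._≟_ b (replicate _ false))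
                   ×-dec All.all? (λ φ → p ∣? sum (map φ (chosen xs b))) Φ)
... | yes (b , b≢0 , zs) = chosen xs b , others xs b , chosen++others xs b , chosen≢[] xs b b≢0 , zs
... | no none = contradiction
  (degLt⇒∣h0 (length xs) _ (degLt-affineProduct cs xs) (≤-trans |cs|< Kp≤)
    (λ b b≢0 → ∣affineProduct-nonzeroShifts p Φ xs b (λ all → none (b , b≢0 , all))))
  (∤affineProduct0 pp cs (∤nonzeroShifts p Φ) xs)
  where
  instance
    p≢0 : NonZero p
    p≢0 = prime⇒nonZero pp
  cs = nonzeroShifts p Φ
  |cs|< : suc (length cs) ≤ K * p
  |cs|< = begin-strict
    length cs                                       ≡⟨ length-cartesianProduct (applyUpTo suc (pred p)) Φ ⟩
    length (applyUpTo suc (pred p)) * length Φ      ≡⟨ cong (_* length Φ) (length-applyUpTo suc (pred p)) ⟩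
    pred p * length Φ                               ≤⟨ *-monoʳ-≤ (pred p) |Φ|≤K ⟩
    -- Strict because `K` is nonzero; the unit gained pays for the `suc` in the degree bound.
    pred p * K                                      <⟨ *-monoˡ-< K (≤-reflexive (suc-pred p)) ⟩
    p * K                                           ≡⟨ *-comm p K ⟩
    K * p                                           ∎
    where open ≤-Reasoning

-- Composite moduli by disjoint blocks

zeroSum-1 : ∀ K → ZeroSum 1 K 1
zeroSum-1 K Φ _ xs@(_ ∷ _) _ = xs , [] , ++-comm [] xs , (λ ()) , All.tabulate (λ _ → 1∣ _)

-- Greedy extraction: each round works on only the first `D` remaining elements and returns those it
-- leaves over, so it consumes at most `D`. Since `P` and the step see the blocks already taken, a
-- new block may be chosen in relation to the earlier ones.
extractBlocks : ∀ {D t} (P : List (List A) → Set) → P [] →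
  (∀ {yss} → P yss → length yss < t → ∀ xs → D ≤ length xs → ∃₂ λ ys zs → xs ↭ ys ++ zs × P (ys ∷ yss)) →
  ∀ xs → t * D ≤ length xs →
  ∃₂ λ yss zs → xs ↭ concat yss ++ zs × length yss ≡ t × P yss
extractBlocks {A = A} {D = D} {t} P p[] step xs = go t xs [] p[] refl
  where
  long : ∀ s xs (zs : List A) → D + s * D ≤ length xs → s * D ≤ length (zs ++ drop D xs)
  long s xs zs sD≤ = begin
    s * D                     ≡⟨ m+n∸m≡n D (s * D) ⟨
    D + s * D ∸ D             ≤⟨ ∸-monoˡ-≤ D sD≤ ⟩
    length xs ∸ D             ≡⟨ length-drop D xs ⟨
    length (drop D xs)        ≤⟨ length-++-≤ʳ (drop D xs) {zs} ⟩
    length (zs ++ drop D xs)  ∎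
    where open ≤-Reasoning
  go : ∀ s (xs : List A) yss → P yss → length yss + s ≡ t → s * D ≤ length xs →
       ∃₂ λ yss′ zs → concat yss ++ xs ↭ concat yss′ ++ zs × length yss′ ≡ t × P yss′
  go zero    xs yss pyss len _    = yss , xs , ↭-refl , trans (sym (+-identityʳ _)) len , pyss
  go (suc s) xs yss pyss len sD≤
    with ys , zs , xs↭ , p′ ← step pyss
           (subst (length yss <_) len (m<m+n (length yss) z<s)) (take D xs)
           (≤-reflexive (sym (trans (length-take D xs) (m≤n⇒m⊓n≡m (m+n≤o⇒m≤o D sD≤)))))
    with yss′ , zs′ , rest↭ , len′ , p″ ← go s (zs ++ drop D xs) (ys ∷ yss) p′
           (trans (sym (+-suc (length yss) s)) len) (long s xs zs sD≤)
    = yss′ , zs′ , ↭-trans regroup rest↭ , len′ , p″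
    where
    regroup : concat yss ++ xs ↭ (ys ++ concat yss) ++ zs ++ drop D xs
    regroup = begin
      concat yss ++ xs                         ≡⟨ cong (concat yss ++_) (take++drop≡id D xs) ⟨
      concat yss ++ take D xs ++ drop D xs     ↭⟨ ++⁺ˡ (concat yss) (++⁺ʳ (drop D xs) xs↭) ⟩
      concat yss ++ (ys ++ zs) ++ drop D xs    ≡⟨ cong (concat yss ++_) (++-assoc ys zs (drop D xs)) ⟩
      concat yss ++ ys ++ zs ++ drop D xs      ↭⟨ shifts (concat yss) ys ⟩
      ys ++ concat yss ++ zs ++ drop D xs      ≡⟨ ++-assoc ys (concat yss) _ ⟨
      (ys ++ concat yss) ++ zs ++ drop D xs    ∎
      where open PermutationReasoning

concat≢[] : ∀ {yss : List (List A)} → yss ≢ [] → All (_≢ []) yss → concat yss ≢ []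
concat≢[] yss≢[] []                            = contradiction refl yss≢[]
concat≢[] yss≢[] (_∷_ {x = []}    ys≢[] _)     = contradiction refl ys≢[]
concat≢[] yss≢[] (_∷_ {x = _ ∷ _} _     _)     = λ ()

concat-↭ : ∀ {xss yss : List (List A)} → xss ↭ yss → concat xss ↭ concat yss
concat-↭ _↭_.refl                  = ↭-refl
concat-↭ (_↭_.prep xs p)           = ++⁺ˡ xs (concat-↭ p)
concat-↭ (_↭_.swap xs ys p)        = ↭-trans (shifts xs ys) (++⁺ˡ ys (++⁺ˡ xs (concat-↭ p)))
concat-↭ (_↭_.trans p q)           = ↭-trans (concat-↭ p) (concat-↭ q)

chooseBlocks : ∀ {xs zs : List A} {yss} uss vss → xs ↭ concat yss ++ zs → yss ↭ uss ++ vss →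
               xs ↭ concat uss ++ concat vss ++ zs
chooseBlocks {xs = xs} {zs} {yss} uss vss xs↭ yss↭ = begin
  xs                               ↭⟨ xs↭ ⟩
  concat yss ++ zs                 ↭⟨ ++⁺ʳ zs (concat-↭ yss↭) ⟩
  concat (uss ++ vss) ++ zs        ≡⟨ cong (_++ zs) (concat-++ uss vss) ⟨
  (concat uss ++ concat vss) ++ zs ≡⟨ ++-assoc (concat uss) (concat vss) zs ⟩
  concat uss ++ concat vss ++ zs   ∎
  where open PermutationReasoning

sum-map-++ : ∀ (φ : A → ℕ) xs ys → sum (map φ (xs ++ ys)) ≡ sum (map φ xs) + sum (map φ ys)
sum-map-++ φ xs ys = trans (cong sum (map-++ φ xs ys)) (sum-++ (map φ xs) (map φ ys))

-- Pulling out `p` turns the quotients of the block sums into coordinates of the blocks: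
-- divisibility of their sum by m becomes divisibility by p·m of the sum over the union.
sum-map-concat : ∀ (φ : A → ℕ) p .{{_ : NonZero p}} {yss} → All (λ ys → p ∣ sum (map φ ys)) yss →
  sum (map φ (concat yss)) ≡ p * sum (map (λ ys → sum (map φ ys) / p) yss)
sum-map-concat φ p []                       = sym (*-zeroʳ p)
sum-map-concat φ p (_∷_ {ys} {yss} p∣ p∣s) = begin
  sum (map φ (ys ++ concat yss))              ≡⟨ sum-map-++ φ ys (concat yss) ⟩
  sum (map φ ys) + sum (map φ (concat yss))   ≡⟨ cong₂ _+_ (sym (m*[n/m]≡n p∣)) (sum-map-concat φ p p∣s) ⟩
  p * q + p * sum (map _ yss)                 ≡⟨ *-distribˡ-+ p q _ ⟨
  p * (q + sum (map _ yss))                   ∎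
  where
  open ≡-Reasoning
  q = sum (map φ ys) / p

-- First `E` disjoint blocks with zero sum modulo `p` are cut off. Their sums divided by `p` are `E`
-- vectors modulo `m`, and the union of a zero-sum choice among these is the required subfamily.
zeroSum-* : ∀ {p m K D E} .{{_ : NonZero p}} → ZeroSum p K D → ZeroSum m K E → ZeroSum (p * m) K (E * D)
zeroSum-* {p} {m} {K} {D} {E} zs-p zs-m {A} Φ |Φ|≤K xs ED≤ =
  let yss , zs , xs↭ , len , blocks = extractBlocks {D = D} {E} (All ZeroBlock) [] step xs ED≤
      uss , vss , yss↭ , uss≢[] , m∣ = zs-m (map (λ φ ys → sum (map φ ys) / p) Φ)
        (subst (_≤ K) (sym (length-map _ Φ)) |Φ|≤K) yss (≤-reflexive (sym len))
      blocks′ = ++⁻ˡ uss (All-resp-↭ yss↭ blocks)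
  in concat uss , concat vss ++ zs , chooseBlocks uss vss xs↭ yss↭ ,
     concat≢[] uss≢[] (All.map proj₁ blocks′) ,
     All.tabulate (λ {φ} φ∈Φ →
       subst (p * m ∣_)
         (sym (sum-map-concat φ p (All.map (λ block → All.lookup (proj₂ block) φ∈Φ) blocks′)))
         (*-monoʳ-∣ p (All.lookup (All-map⁻ m∣) φ∈Φ)))
  where
  ZeroBlock : List A → Set
  ZeroBlock ys = ys ≢ [] × All (λ φ → p ∣ sum (map φ ys)) Φ
  step : ∀ {yss} → All ZeroBlock yss → length yss < E → ∀ xs → D ≤ length xs →
         ∃₂ λ ys zs → xs ↭ ys ++ zs × All ZeroBlock (ys ∷ yss)
  step blocks _ xs D≤ =
    let ys , zs , xs↭ , block = zs-p Φ |Φ|≤K xs D≤ in ys , zs , xs↭ , block ∷ blocks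

-- Each prime p contributes a factor K·p to the length required.
zeroSum : ∀ {ps} → All Prime ps → ∀ K .{{_ : NonZero K}} →
          ZeroSum (product ps) K (K ^ length ps * product ps)
zeroSum []                     K = zeroSum-1 K
zeroSum (_∷_ {p} {ps} pp pps) K =
  subst (ZeroSum (p * product ps) K) (regroup (K ^ length ps) (product ps) K p)
    (zeroSum-* {{prime⇒nonZero pp}} (zeroSum-prime pp K) (zeroSum pps K))
  where
  regroup : ∀ a b c d → a * b * (c * d) ≡ c * a * (d * b)
  regroup = solve-∀

-- Quadratic polynomials on disjoint blocks of variables

AllPairs-++⁻ : ∀ {R : A → A → Set} xs {ys} → AllPairs R (xs ++ ys) →
               AllPairs R xs × All (λ x → All (R x) ys) xs
AllPairs-++⁻ []       _          = [] , []
AllPairs-++⁻ (x ∷ xs) (rx ∷ rxs) =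
  let pairs , across = AllPairs-++⁻ xs rxs in ++⁻ˡ xs rx ∷ pairs , ++⁻ʳ xs rx ∷ across

AllPairs-resp-↭ : ∀ {R : A → A → Set} → (∀ {x y} → R x y → R y x) →
                  ∀ {xs ys} → xs ↭ ys → AllPairs R xs → AllPairs R ys
AllPairs-resp-↭ {R = R} R-sym xs↭ys =
  Permutationₛ.AllPairs-resp-↭ (setoid _) R-sym (resp₂ R) (↭⇒↭ₛ xs↭ys)

module Quadratic (a : A → ℕ) (b : A → A → ℕ) where

  -- `cross` is the polar form of `value`, the amount by which `value` fails to be additive; it is
  -- symmetrised because `b i j` and `b j i` are independent coefficients.
  bilinear cross : List A → List A → ℕ
  bilinear S T = sum (map (λ i → sum (map (b i) T)) S)
  cross S T = bilinear S T + bilinear T S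

  value : List A → ℕ
  value T = sum (map a T) + bilinear T T

  bilinear-[]ʳ : ∀ S → bilinear S [] ≡ 0
  bilinear-[]ʳ []      = refl
  bilinear-[]ʳ (_ ∷ S) = bilinear-[]ʳ S

  bilinear-++ˡ : ∀ S S′ T → bilinear (S ++ S′) T ≡ bilinear S T + bilinear S′ T
  bilinear-++ˡ S S′ T = sum-map-++ _ S S′

  private
    interchange : ∀ u v w x → u + v + (w + x) ≡ u + w + (v + x)
    interchange = solve-∀

  bilinear-++ʳ : ∀ S T T′ → bilinear S (T ++ T′) ≡ bilinear S T + bilinear S T′
  bilinear-++ʳ []      T T′ = refl
  bilinear-++ʳ (i ∷ S) T T′ =
    trans (cong₂ _+_ (sum-map-++ (b i) T T′) (bilinear-++ʳ S T T′))
          (interchange (sum (map (b i) T)) (sum (map (b i) T′)) (bilinear S T) (bilinear S T′))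

  cross-++ʳ : ∀ S T T′ → cross S (T ++ T′) ≡ cross S T + cross S T′
  cross-++ʳ S T T′ =
    trans (cong₂ _+_ (bilinear-++ʳ S T T′) (bilinear-++ˡ T T′ S))
          (interchange (bilinear S T) (bilinear S T′) (bilinear T S) (bilinear T′ S))

  cross-[]ʳ : ∀ S → cross S [] ≡ 0
  cross-[]ʳ S = trans (+-identityʳ _) (bilinear-[]ʳ S)

  -- Presents `cross S` as a coordinate summed over elements, the shape to which `ZeroSum` applies.
  sum-cross-singletons : ∀ S T → sum (map (λ j → cross S [ j ]) T) ≡ cross S T
  sum-cross-singletons S []      = sym (cross-[]ʳ S)
  sum-cross-singletons S (j ∷ T) =
    trans (cong (λ t → cross S [ j ] + t) (sum-cross-singletons S T)) (sym (cross-++ʳ S [ j ] T))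

  value-++ : ∀ S T → value (S ++ T) ≡ value S + value T + cross S T
  value-++ S T = begin
    value (S ++ T)
      ≡⟨ cong₂ _+_ (sum-map-++ a S T)
          (trans (bilinear-++ˡ S T (S ++ T)) (cong₂ _+_ (bilinear-++ʳ S S T) (bilinear-++ʳ T S T))) ⟩
    sum (map a S) + sum (map a T)
      + ((bilinear S S + bilinear S T) + (bilinear T S + bilinear T T))
      ≡⟨ regroup (sum (map a S)) (sum (map a T)) (bilinear S S) (bilinear S T) (bilinear T S) (bilinear T T) ⟩
    value S + value T + cross S T ∎
    where
    open ≡-Reasoning
    regroup : ∀ s t ss st ts tt → s + t + ((ss + st) + (ts + tt)) ≡ s + ss + (t + tt) + (st + ts)
    regroup = solve-∀

  Orthogonal : ℕ → List A → List A → Set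
  Orthogonal m S T = m ∣ cross S T

  orthogonal-concat : ∀ {m} S {Ts} → All (Orthogonal m S) Ts → Orthogonal m S (concat Ts)
  orthogonal-concat {m} S []                        = subst (m ∣_) (sym (cross-[]ʳ S)) (m ∣0)
  orthogonal-concat {m} S (_∷_ {T} {Ts} S⊥T S⊥Ts) =
    subst (m ∣_) (sym (cross-++ʳ S T (concat Ts))) (∣m∣n⇒∣m+n S⊥T (orthogonal-concat S S⊥Ts))

  value-concat : ∀ {m Ss} → AllPairs (Orthogonal m) Ss →
                 m ∣ sum (map value Ss) → m ∣ value (concat Ss)
  value-concat {m} orth m∣ =
    let e , eq , m∣e = defect orth in subst (m ∣_) (sym eq) (∣m∣n⇒∣m+n m∣ m∣e)
    where
    -- Additivity modulo `m` is expressed by an explicit surplus `e`, which avoids subtraction in ℕ.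
    defect : ∀ {Ss} → AllPairs (Orthogonal m) Ss →
             ∃ λ e → value (concat Ss) ≡ sum (map value Ss) + e × m ∣ e
    defect []                          = 0 , refl , m ∣0
    defect (_∷_ {S} {Ss} S⊥ orth) =
      let e , eq , m∣e = defect orth in
      e + cross S (concat Ss) ,
      trans (value-++ S (concat Ss))
        (trans (cong (λ v → value S + v + cross S (concat Ss)) eq)
               (regroup (value S) (sum (map value Ss)) e (cross S (concat Ss)))) ,
      ∣m∣n⇒∣m+n m∣e (orthogonal-concat S S⊥)
      where
      regroup : ∀ s t e c → s + (t + e) + c ≡ s + t + (e + c)
      regroup = solve-∀

  -- Before each round fewer than `t` blocks are present, so they impose fewer than `t` linear
  -- conditions on a new block; a zero-sum subfamily for these linear forms meets them all.
  orthogonalBlocks : ∀ {m t D} → ZeroSum m t D → ∀ xs → t * D ≤ length xs →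
    ∃₂ λ Ss zs → xs ↭ concat Ss ++ zs × length Ss ≡ t × All (_≢ []) Ss × AllPairs (Orthogonal m) Ss
  orthogonalBlocks {m} {t} {D} zs-m =
    extractBlocks (λ Ss → All (_≢ []) Ss × AllPairs (Orthogonal m) Ss) ([] , []) step
    where
    step : ∀ {Ss} → All (_≢ []) Ss × AllPairs (Orthogonal m) Ss → length Ss < t →
           ∀ xs → D ≤ length xs →
           ∃₂ λ T zs → xs ↭ T ++ zs × All (_≢ []) (T ∷ Ss) × AllPairs (Orthogonal m) (T ∷ Ss)
    step {Ss} (Ss≢[] , orth) |Ss|<t xs D≤ =
      let T , zs , xs↭ , T≢[] , m∣ = zs-m (map (λ S j → cross S [ j ]) Ss)
            (subst (_≤ t) (sym (length-map _ Ss)) (<⇒≤ |Ss|<t)) xs D≤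
      in T , zs , xs↭ , T≢[] ∷ Ss≢[] ,
         All.map (λ {S} m∣S → subst (m ∣_) (trans (sum-cross-singletons S T) (+-comm (bilinear S T) _)) m∣S)
                 (All-map⁻ m∣) ∷ orth

  zeroValue : ∀ {ps} → All Prime ps → let m = product ps in .{{_ : NonZero m}} →
    ∀ xs → m * (m ^ length ps * m) ≤ length xs →
    ∃₂ λ T zs → xs ↭ T ++ zs × T ≢ [] × m ∣ value T
  zeroValue {ps} pps xs enough =
    let m = product ps
        Ss , zs , xs↭ , len , Ss≢[] , orth = orthogonalBlocks (zeroSum pps m) xs enough
        -- The blocks now play the part of elements, with `value` as their only coordinate; for K =
        -- 1 the length required is `m`, exactly the number of blocks extracted.
        Us , Vs , Ss↭ , Us≢[] , m∣ = zeroSum pps 1 [ value ] ≤-refl Ss (≤-reflexive (begin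
          1 ^ length ps * m  ≡⟨ cong (_* m) (^-zeroˡ (length ps)) ⟩
          1 * m              ≡⟨ *-identityˡ m ⟩
          m                  ≡⟨ len ⟨
          length Ss          ∎))
        orth′ = proj₁ (AllPairs-++⁻ Us (AllPairs-resp-↭ (λ {S} {T} → subst (m ∣_) (+-comm (bilinear S T) _)) Ss↭ orth))
    in concat Us , concat Vs ++ zs , chooseBlocks Us Vs xs↭ Ss↭ ,
       concat≢[] Us≢[] (++⁻ˡ Us (All-resp-↭ Ss↭ Ss≢[])) , value-concat orth′ (All.head m∣)
    where open ≡-Reasoning

-- Evaluation at indicator vectors

open module FinMembership {n : ℕ} = DecMembership (_≟_ {n}) using (_∈?_)

indicator : ∀ {n} → List (Fin n) → BVec n
indicator T i = does (i ∈? T)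

sumFin-cong : ∀ n {g h : Fin n → ℕ} → (∀ i → g i ≡ h i) → sumFin n g ≡ sumFin n h
sumFin-cong zero    g≗h = refl
sumFin-cong (suc n) g≗h = cong₂ _+_ (g≗h zero) (sumFin-cong n (g≗h ∘ suc))

sumFin≡sum : ∀ n (g : Fin n → ℕ) → sumFin n g ≡ sum (map g (allFin n))
sumFin≡sum n g = trans (sum-tabulate n g) (cong sum (sym (map-tabulate id g)))
  where
  sum-tabulate : ∀ n (g : Fin n → ℕ) → sumFin n g ≡ sum (tabulate g)
  sum-tabulate zero    g = refl
  sum-tabulate (suc n) g = cong (λ t → g zero + t) (sum-tabulate n (g ∘ suc))

sum-map-*ʳ : ∀ (g : A → ℕ) c xs → sum (map (λ x → g x * c) xs) ≡ sum (map g xs) * c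
sum-map-*ʳ g c []       = refl
sum-map-*ʳ g c (x ∷ xs) =
  trans (cong (λ t → g x * c + t) (sum-map-*ʳ g c xs)) (sym (*-distribʳ-+ c (g x) _))

module _ {n : ℕ} (T : List (Fin n)) {R : List (Fin n)} (split : allFin n ↭ T ++ R) where

  private
    T∌R : ∀ {i} → i ∈ R → ¬ (i ∈ T)
    T∌R i∈R i∈T = All.lookup (All.lookup (proj₂ (AllPairs-++⁻ T unique)) i∈T) i∈R refl
      where unique = AllPairs-resp-↭ (λ x≢y y≡x → x≢y (sym y≡x)) split (allFin⁺ n)

  -- The sum is rearranged along `split`. `T` and `R` are disjoint because `allFin n` has no
  -- repetitions, so the indicator is 1 on `T` and 0 on `R`.
  sumFin-indicator : (g : Fin n → ℕ) →
                     sumFin n (λ i → g i * val (indicator T i)) ≡ sum (map g T)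
  sumFin-indicator g = begin
    sumFin n h                        ≡⟨ sumFin≡sum n h ⟩
    sum (map h (allFin n))            ≡⟨ sum-↭ (map⁺ h split) ⟩
    sum (map h (T ++ R))              ≡⟨ sum-map-++ h T R ⟩
    sum (map h T) + sum (map h R)     ≡⟨ cong₂ (λ u v → sum u + sum v)
                                           (map-cong-local (All.tabulate on)) (map-cong-local (All.tabulate off)) ⟩
    sum (map g T) + sum (map (λ _ → 0) R)
      ≡⟨ cong (λ t → sum (map g T) + t) (trans (sum-map-*ʳ (λ _ → 0) 0 R) (*-zeroʳ (sum (map (λ _ → 0) R)))) ⟩
    sum (map g T) + 0                 ≡⟨ +-identityʳ _ ⟩
    sum (map g T)                     ∎
    where
    open ≡-Reasoning
    h = λ i → g i * val (indicator T i)
    on : ∀ {i} → i ∈ T → h i ≡ g i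
    on {i} i∈T = trans (cong (λ v → g i * val v) (dec-true (i ∈? T) i∈T)) (*-identityʳ (g i))
    off : ∀ {i} → i ∈ R → h i ≡ 0
    off {i} i∈R = trans (cong (λ v → g i * val v) (dec-false (i ∈? T) (T∌R i∈R))) (*-zeroʳ (g i))

  eval-indicator : ∀ {m} .{{_ : NonZero m}} (f : Deg2Poly m n) →
    eval f (indicator T) ≡
    (toℕ (const f) + Quadratic.value (toℕ ∘ lin f) (λ i j → toℕ (quad f i j)) T) mod m
  eval-indicator {m} f = cong (_mod m) (trans (+-assoc (toℕ (const f)) _ _)
    (cong (λ t → toℕ (const f) + t) (cong₂ _+_ (sumFin-indicator (toℕ ∘ lin f)) quadratic)))
    where
    x = val ∘ indicator T
    q = λ i j → toℕ (quad f i j)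
    quadratic : sumFin n (λ i → sumFin n (λ j → q i j * x i * x j)) ≡ sum (map (λ i → sum (map (q i) T)) T)
    quadratic = trans
      -- The inner sum over j is restricted to `T` first, with `x i` still inside; pulling `x i` out
      -- brings the outer sum into the same form.
      (sumFin-cong n (λ i → trans (sumFin-indicator (λ j → q i j * x i)) (sum-map-*ʳ (q i) (x i) T)))
      (sumFin-indicator (λ i → sum (map (q i) T)))

-- The right side keeps `c + 0` because it is to match the evaluation at the empty list, where
-- `value []` reduces to 0.
mod-+-∣ : ∀ {m} .{{_ : NonZero m}} c {v} → m ∣ v → (c + v) mod m ≡ (c + 0) mod m
mod-+-∣ {m} c (divides k refl) = toℕ-injective (begin
  toℕ ((c + k * m) mod m)  ≡⟨ toℕ-fromℕ< _ ⟩
  (c + k * m) % m          ≡⟨ [m+kn]%n≡m%n c k m ⟩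
  c % m                    ≡⟨ cong (_% m) (+-identityʳ c) ⟨
  (c + 0) % m              ≡⟨ toℕ-fromℕ< _ ⟨
  toℕ ((c + 0) mod m)      ∎)
  where open ≡-Reasoning

-- Weak representation of OR

OR≡true : ∀ {n} (x : BVec n) i → x i ≡ true → OR n x ≡ true
OR≡true x zero    xi rewrite xi = refl
OR≡true x (suc i) xi = trans (cong (x zero ∨_) (OR≡true (x ∘ suc) i xi)) (Bool.∨-zeroʳ (x zero))

OR-zero : ∀ n → OR n (λ _ → false) ≡ false
OR-zero zero    = refl
OR-zero (suc n) = OR-zero n

-- For larger n some nonempty set `T` of variables has f(1_T) = f(0). Membership in `A` cannot
-- separate equal values, whereas OR separates 1_T from 0.
OR-bound : ∀ {ps} → All Prime ps → let m = product ps in .{{_ : NonZero m}} →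
           ∀ {n} (f : Deg2Poly m n) → WeaklyRepresents f (OR n) → n < m * (m ^ length ps * m)
OR-bound {ps} pps {n} f (A , represents) = ≰⇒> λ enough →
  let T , R , split , T≢[] , m∣ = Quadratic.zeroValue (toℕ ∘ lin f) (λ i j → toℕ (quad f i j)) pps
        (allFin n) (≤-trans enough (≤-reflexive (sym (length-tabulate id))))
      same = trans (eval-indicator T split f)
               (trans (mod-+-∣ (toℕ (const f)) m∣) (sym (eval-indicator [] ↭-refl f)))
      -- `indicator []` reduces to the constant `false`, so the origin is treated as the case of the
      -- empty list.
      f0∈A = Equivalence.to (represents (indicator [])) (OR-zero n)
      or≡false = Equivalence.from (represents (indicator T)) (subst (Subset._∈ A) (sym same) f0∈A)
  in nonempty T T≢[] or≡false
  where
  nonempty : ∀ T → T ≢ [] → ¬ (OR n (indicator T) ≡ false)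
  nonempty []      T≢[] = contradiction refl T≢[]
  nonempty (i ∷ T) _    or≡false
    with () ← trans (sym (OR≡true (indicator (i ∷ T)) i (dec-true (i ∈? (i ∷ T)) (here refl)))) or≡false

-- The bound in terms of d and log m

2^length≤product : ∀ {ps} → All Prime ps → 2 ^ length ps ≤ product ps
2^length≤product []         = ≤-refl
2^length≤product (pp ∷ pps) =
  *-mono-≤ (nonTrivial⇒n>1 _ {{prime⇒nonTrivial pp}}) (2^length≤product pps)

-- Every prime is at least 2. Since the floor does not exceed log₂ m, the resulting inequality
-- implies the one with the real logarithm.
length≤log₂ : ∀ {ps} → All Prime ps → length ps ≤ ⌊log₂ product ps ⌋
length≤log₂ {ps} pps =
  subst (_≤ ⌊log₂ product ps ⌋) (⌊log₂[2^n]⌋≡n (length ps)) (⌊log₂⌋-mono-≤ (2^length≤product pps))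

-- The source of C = 3: the exponent is d + 2, and 2 ≤ 2d as soon as d ≥ 1.
m*m^d*m≤m^3d : ∀ m .{{_ : NonZero m}} d .{{_ : NonZero d}} → m * (m ^ d * m) ≤ m ^ (3 * d)
m*m^d*m≤m^3d m d@(suc e) = begin
  m * (m ^ d * m)   ≡⟨ cong (m *_) (*-comm (m ^ d) m) ⟩
  m ^ (2 + d)       ≤⟨ ^-monoʳ-≤ m (begin
    2 + d             ≤⟨ +-monoˡ-≤ d (*-monoʳ-≤ 2 (s≤s (z≤n {e}))) ⟩
    2 * d + d         ≡⟨ +-comm (2 * d) d ⟩
    3 * d             ∎) ⟩
  m ^ (3 * d)       ∎
  where open ≤-Reasoning

theorem1p2 : ∃ λ (C : ℕ) → (m : ℕ) .{{_ : NonZero m}} → 1 < m →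
    (pf : PrimeFactorisation m) → (n : ℕ) → (f : Deg2Poly m n) →
    WeaklyRepresents f (OR n) →
    (n ≤ m ^ (C * length (factors pf))) × (m ^ (C * length (factors pf)) ≤ m ^ (C * ⌊log₂ m ⌋))
theorem1p2 = 3 , bound
  where
  bound : (m : ℕ) .{{_ : NonZero m}} → 1 < m →
    (pf : PrimeFactorisation m) → (n : ℕ) → (f : Deg2Poly m n) →
    WeaklyRepresents f (OR n) →
    (n ≤ m ^ (3 * length (factors pf))) × (m ^ (3 * length (factors pf)) ≤ m ^ (3 * ⌊log₂ m ⌋))
  -- An empty factorisation forces m = 1; excluding it supplies d ≥ 1 for the exponent estimate.
  bound m 1<m record { factors = [] ; isFactorisation = refl } = contradiction 1<m (<-irrefl refl)
  bound m 1<m record { factors = ps@(_ ∷ _) ; isFactorisation = refl ; factorsPrime = pps } n f f-OR =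
    <⇒≤ (<-≤-trans (OR-bound pps f f-OR) (m*m^d*m≤m^3d m (length ps))) ,
    ^-monoʳ-≤ m (*-monoʳ-≤ 3 (length≤log₂ pps))
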